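{- Let $n\geq 3$ and let $\pi_i f=\partial_i(P^{+}f)+Q_{+}\partial_i f+R_{+}f$, $1\leq i\leq n-1$, be a family of operators of one of the following two kinds, where $a,b,c,d$ are constants, not all $0$, with $ad-bc=0$. (1) For some constant $e$ that equals neither $0$ nor $b-c$, for all $i$ we have $P^{+}=a x_i x_{i+1}+(b-e)x_i+c x_{i+1}+d$, $Q_{+}=e x_i$, $R_{+}=0$. (2) For every $i$ independently, $(P^{+},Q_{+},R_{+})$ is one of the four triples - $\big(a x_i x_{i+1}+b x_i+c x_{i+1}+d,\ 0,\ 0\big)$; - $\big(a x_i x_{i+1}+c x_i+c x_{i+1}+d,\ (b-c)x_i,\ 0\big)$; - $\big(a x_i^2+(b+c)x_i+c x_{i+1}+d,\ -c x_i,\ -a x_i\big)$; - $\big(c x_{i+1}+d,\ a x_i^2+b x_i,\ -a x_i\big)$. Then the operators $\{\pi_i\}_{i=1}^{n-1}$ generate a Hecke algebra $\mathcal{H}_{b-c,\nu}$, where $\nu$ equals $e(e+c-b)$ in case (1) and $0$ in case (2).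
   Context: $K$ is a field of arbitrary characteristic over which all polynomials are defined; possible extra parameters are regarded as elements of $K$, so "constant" means an element of $K$. The operators act on functions $f$ of variables $x_1,\dots,x_n$ (concretely $f\in K[x_1,\dots,x_n]$). The operator $s_i$ interchanges $x_i$ and $x_{i+1}$, and $\partial_i f=\frac{f-s_i f}{x_i-x_{i+1}}$. Operators $\{\pi_i\}_{i=1}^{n-1}$ generate a Hecke algebra $\mathcal{H}_{\mu,\nu}$ if they satisfy the braid relations ($\pi_i\pi_k=\pi_k\pi_i$ for $|k-i|\geq 2$ and $\pi_i\pi_{i+1}\pi_i=\pi_{i+1}\pi_i\pi_{i+1}$ for $1\leq i\leq n-2$) and $\pi_i^2=\mu\pi_i+\nu\operatorname{Id}$ for every $1\leq i\leq n-1$. -}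

module Defs where

open import Algebra.Apartness.Bundles using (HeytingField; HeytingCommutativeRing)
open import Algebra.Bundles using (CommutativeRing)
open import Algebra.Structures using (IsCommutativeRing)
import Algebra.Properties.Ring as RingProperties
import Algebra.Solver.Ring.NaturalCoefficients.Default as SemiringSolver
open import Data.Fin.Base using (Fin; zero; suc; inject₁; toℕ)
open import Data.Fin.Patterns using (0F; 1F; 2F; 3F)
open import Data.Fin.Permutation.Components using (transpose)
open import Data.Fin.Properties using (_≟_; toℕ-inject₁)
open import Data.Nat.Base using (ℕ; zero; suc; pred; _≤_; ∣_-_∣)
open import Data.Nat.Properties using (1+n≢n)
open import Data.Product.Base using (∃-syntax; _,_; proj₁; proj₂)
open import Function.Bundles using (Func; _⟨$⟩_)
open import Level using (_⊔_)
open import Relation.Binary.PropositionalEquality as ≡ using (_≡_; _≢_)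
import Relation.Binary.Reasoning.Setoid as SetoidReasoning
open import Relation.Nullary.Decidable using (Dec; yes; no)
open import Relation.Nullary.Negation using (contradiction)

------------------------------------------------------------------------
-- The polynomial ring K[x₀,…,xₙ₋₁], presented as the free commutative
-- K-algebra on n generators: terms modulo the least congruence that
-- contains the commutative ring laws and makes `con` a homomorphism.

module Polynomials {c ℓ} (K : CommutativeRing c ℓ) (n : ℕ) where

  private module K = CommutativeRing K

  infixl 6 _:+_
  infixl 7 _:*_
  infix  8 :-_
  infix  4 _≈ₚ_

  data Poly : Set c where
    con  : K.Carrier → Poly
    var  : Fin n → Poly
    _:+_ : Poly → Poly → Poly
    _:*_ : Poly → Poly → Poly
    :-_  : Poly → Poly

  data _≈ₚ_ : Poly → Poly → Set (c ⊔ ℓ) where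
    refl        : ∀ {f} → f ≈ₚ f
    sym         : ∀ {f g} → f ≈ₚ g → g ≈ₚ f
    trans       : ∀ {f g h} → f ≈ₚ g → g ≈ₚ h → f ≈ₚ h
    +-cong      : ∀ {f f′ g g′} → f ≈ₚ f′ → g ≈ₚ g′ → f :+ g ≈ₚ f′ :+ g′
    *-cong      : ∀ {f f′ g g′} → f ≈ₚ f′ → g ≈ₚ g′ → f :* g ≈ₚ f′ :* g′
    -‿cong      : ∀ {f f′} → f ≈ₚ f′ → :- f ≈ₚ :- f′
    +-assoc     : ∀ f g h → (f :+ g) :+ h ≈ₚ f :+ (g :+ h)
    +-comm      : ∀ f g → f :+ g ≈ₚ g :+ f
    +-identityˡ : ∀ f → con K.0# :+ f ≈ₚ f
    -‿inverseˡ  : ∀ f → :- f :+ f ≈ₚ con K.0#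
    *-assoc     : ∀ f g h → (f :* g) :* h ≈ₚ f :* (g :* h)
    *-comm      : ∀ f g → f :* g ≈ₚ g :* f
    *-identityˡ : ∀ f → con K.1# :* f ≈ₚ f
    distribˡ    : ∀ f g h → f :* (g :+ h) ≈ₚ f :* g :+ f :* h
    con-cong    : ∀ {a b} → a K.≈ b → con a ≈ₚ con b
    con-+       : ∀ a b → con (a K.+ b) ≈ₚ con a :+ con b
    con-*       : ∀ a b → con (a K.* b) ≈ₚ con a :* con b

  private
    isCommutativeRing : IsCommutativeRing _≈ₚ_ _:+_ _:*_ :-_ (con K.0#) (con K.1#)
    isCommutativeRing = record
      { isRing = record
        { +-isAbelianGroup = record
          { isGroup = record
            { isMonoid = record
              { isSemigroup = record
                { isMagma = record
                  { isEquivalence = record { refl = refl ; sym = sym ; trans = trans }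
                  ; ∙-cong = +-cong
                  }
                ; assoc = +-assoc
                }
              ; identity = +-identityˡ , λ f → trans (+-comm _ _) (+-identityˡ f)
              }
            ; inverse = -‿inverseˡ , λ f → trans (+-comm _ _) (-‿inverseˡ f)
            ; ⁻¹-cong = -‿cong
            }
          ; comm = +-comm
          }
        ; *-cong = *-cong
        ; *-assoc = *-assoc
        ; *-identity = *-identityˡ , λ f → trans (*-comm _ _) (*-identityˡ f)
        ; distrib = distribˡ , λ f g h →
            trans (*-comm _ _) (trans (distribˡ f g h) (+-cong (*-comm _ _) (*-comm _ _)))
        }
      ; *-comm = *-comm
      }

  polynomialRing : CommutativeRing c (c ⊔ ℓ)
  polynomialRing = record { isCommutativeRing = isCommutativeRing }

  -- Substitution of σ k for the k-th variable.

  infix 9 _[_]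

  _[_] : Poly → (Fin n → Poly) → Poly
  con a    [ σ ] = con a
  var k    [ σ ] = σ k
  (f :+ g) [ σ ] = f [ σ ] :+ g [ σ ]
  (f :* g) [ σ ] = f [ σ ] :* g [ σ ]
  (:- f)   [ σ ] = :- (f [ σ ])

  []-cong : ∀ σ {f g} → f ≈ₚ g → f [ σ ] ≈ₚ g [ σ ]
  []-cong σ refl            = refl
  []-cong σ (sym p)         = sym ([]-cong σ p)
  []-cong σ (trans p q)     = trans ([]-cong σ p) ([]-cong σ q)
  []-cong σ (+-cong p q)    = +-cong ([]-cong σ p) ([]-cong σ q)
  []-cong σ (*-cong p q)    = *-cong ([]-cong σ p) ([]-cong σ q)
  []-cong σ (-‿cong p)      = -‿cong ([]-cong σ p)
  []-cong σ (+-assoc f g h) = +-assoc _ _ _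
  []-cong σ (+-comm f g)    = +-comm _ _
  []-cong σ (+-identityˡ f) = +-identityˡ _
  []-cong σ (-‿inverseˡ f)  = -‿inverseˡ _
  []-cong σ (*-assoc f g h) = *-assoc _ _ _
  []-cong σ (*-comm f g)    = *-comm _ _
  []-cong σ (*-identityˡ f) = *-identityˡ _
  []-cong σ (distribˡ f g h) = distribˡ _ _ _
  []-cong σ (con-cong p)    = con-cong p
  []-cong σ (con-+ a b)     = con-+ a b
  []-cong σ (con-* a b)     = con-* a b

  open CommutativeRing polynomialRing
    using (_-_; 0#; 1#; +-identityʳ; -‿inverseʳ; zeroˡ; zeroʳ; *-identityʳ
          ; +-congˡ; +-congʳ; *-congˡ; *-congʳ; setoid; ring; commutativeSemiring)
  open RingProperties ring using (-‿distribʳ-*; -0#≈0#; -‿+-comm; -1*x≈-x)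
  open SetoidReasoning setoid
  private module S = SemiringSolver commutativeSemiring

  x-y+y≈x : ∀ x y → (x - y) :+ y ≈ₚ x
  x-y+y≈x x y = trans (+-assoc _ _ _) (trans (+-congˡ (-‿inverseˡ y)) (+-identityʳ x))

  x+y-y≈x : ∀ x y → (x :+ y) - y ≈ₚ x
  x+y-y≈x x y = trans (+-assoc _ _ _) (trans (+-congˡ (-‿inverseʳ y)) (+-identityʳ x))

  -- If d divides x_k - σ(x_k) for every k, then d divides f - σ(f) for
  -- every f, by the twisted Leibniz rule
  --   fg - σ(f)σ(g) = (f - σ(f)) g + σ(f) (g - σ(g)).
  module Division
    (d : Poly) (σ t : Fin n → Poly) (d*t : ∀ k → d :* t k ≈ₚ var k - σ k)
    where

    private
      divide : ∀ f → ∃[ q ] d :* q :+ f [ σ ] ≈ₚ f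
      divide (con a) = 0# , trans (+-congʳ (zeroʳ d)) (+-identityˡ _)
      divide (var k) = t k , trans (+-congʳ (d*t k)) (x-y+y≈x _ _)
      divide (f :+ g) =
        let (f′ , p) = divide f ; (g′ , q) = divide g in
        f′ :+ g′ , trans
          (S.solve 5 (λ d f′ g′ u v → d S.:* (f′ S.:+ g′) S.:+ (u S.:+ v)
             S.:= (d S.:* f′ S.:+ u) S.:+ (d S.:* g′ S.:+ v)) refl d f′ g′ _ _)
          (+-cong p q)
      divide (f :* g) =
        let (f′ , p) = divide f ; (g′ , q) = divide g in
        f′ :* g :+ f [ σ ] :* g′ , (begin
          d :* (f′ :* g :+ f [ σ ] :* g′) :+ f [ σ ] :* g [ σ ]
            ≈⟨ S.solve 6 (λ d f′ g u g′ v →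
                 d S.:* (f′ S.:* g S.:+ u S.:* g′) S.:+ u S.:* v
                 S.:= (d S.:* f′) S.:* g S.:+ u S.:* (d S.:* g′ S.:+ v))
                 refl d f′ g _ g′ _ ⟩
          (d :* f′) :* g :+ f [ σ ] :* (d :* g′ :+ g [ σ ])
            ≈⟨ +-congˡ (*-congˡ q) ⟩
          (d :* f′) :* g :+ f [ σ ] :* g
            ≈⟨ S.solve 3 (λ a g u → a S.:* g S.:+ u S.:* g S.:= (a S.:+ u) S.:* g)
                 refl (d :* f′) g _ ⟩
          (d :* f′ :+ f [ σ ]) :* g
            ≈⟨ *-congʳ p ⟩
          f :* g ∎)
      divide (:- f) =
        let (f′ , p) = divide f in
        :- f′ , trans (+-congʳ (sym (-‿distribʳ-* d f′)))
                  (trans (-‿+-comm _ _) (-‿cong p))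

    quotient : ∀ f → ∃[ q ] d :* q ≈ₚ f - f [ σ ]
    quotient f = let (q , p) = divide f in
      q , trans (sym (x+y-y≈x _ _)) (+-congʳ p)

    private
      D : Poly → Poly
      D f = proj₁ (quotient f)

    quotient-cong : ∀ {f g} → f ≈ₚ g → proj₁ (quotient f) ≈ₚ proj₁ (quotient g)
    quotient-cong refl            = refl
    quotient-cong (sym p)         = sym (quotient-cong p)
    quotient-cong (trans p q)     = trans (quotient-cong p) (quotient-cong q)
    quotient-cong (+-cong p q)    = +-cong (quotient-cong p) (quotient-cong q)
    quotient-cong (*-cong p q)    =
      +-cong (*-cong (quotient-cong p) q) (*-cong ([]-cong σ p) (quotient-cong q))
    quotient-cong (-‿cong p)      = -‿cong (quotient-cong p)
    quotient-cong (+-assoc f g h) = +-assoc _ _ _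
    quotient-cong (+-comm f g)    = +-comm _ _
    quotient-cong (+-identityˡ f) = +-identityˡ _
    quotient-cong (-‿inverseˡ f)  = -‿inverseˡ _
    quotient-cong (*-assoc f g h) =
      S.solve 7 (λ f′ g′ h′ g h u v →
        (f′ S.:* g S.:+ u S.:* g′) S.:* h S.:+ (u S.:* v) S.:* h′
        S.:= f′ S.:* (g S.:* h) S.:+ u S.:* (g′ S.:* h S.:+ v S.:* h′))
        refl (D f) (D g) (D h) g h (f [ σ ]) (g [ σ ])
    quotient-cong (*-comm f g) = begin
      D f :* g :+ f [ σ ] :* D g
        ≈⟨ +-congʳ (*-congˡ (sym (proj₂ (divide g)))) ⟩
      D f :* (d :* D g :+ g [ σ ]) :+ f [ σ ] :* D g
        ≈⟨ S.solve 5 (λ d f′ g′ u v →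
             f′ S.:* (d S.:* g′ S.:+ v) S.:+ u S.:* g′
             S.:= g′ S.:* (d S.:* f′ S.:+ u) S.:+ v S.:* f′)
             refl d (D f) (D g) (f [ σ ]) (g [ σ ]) ⟩
      D g :* (d :* D f :+ f [ σ ]) :+ g [ σ ] :* D f
        ≈⟨ +-congʳ (*-congˡ (proj₂ (divide f))) ⟩
      D g :* f :+ g [ σ ] :* D f ∎
    quotient-cong (*-identityˡ f) =
      trans (+-cong (zeroˡ _) (*-identityˡ _)) (+-identityˡ _)
    quotient-cong (distribˡ f g h) =
      S.solve 6 (λ f′ g′ h′ g h u →
        f′ S.:* (g S.:+ h) S.:+ u S.:* (g′ S.:+ h′)
        S.:= (f′ S.:* g S.:+ u S.:* g′) S.:+ (f′ S.:* h S.:+ u S.:* h′))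
        refl (D f) (D g) (D h) g h (f [ σ ])
    quotient-cong (con-cong p)    = refl
    quotient-cong (con-+ a b)     = sym (+-identityˡ _)
    quotient-cong (con-* a b)     =
      sym (trans (+-cong (zeroˡ _) (zeroʳ _)) (+-identityˡ _))

  private
    assign : ∀ {k i : Fin n} → Dec (k ≡ i) → Poly → Poly → Poly
    assign (yes _) f g = f
    assign (no _)  f g = g

    assign-no : ∀ {i j : Fin n} → i ≢ j → ∀ (i≟j : Dec (i ≡ j)) (f g : Poly) → assign i≟j f g ≡ g
    assign-no i≢j (yes p) f g = contradiction p i≢j
    assign-no i≢j (no _)  f g = ≡.refl

    assign-yes : ∀ {i : Fin n} (i≟i : Dec (i ≡ i)) (f g : Poly) → assign i≟i f g ≡ f
    assign-yes (yes _) f g = ≡.refl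
    assign-yes (no p)  f g = contradiction ≡.refl p

    reflexive : ∀ {f g} → f ≡ g → f ≈ₚ g
    reflexive ≡.refl = refl

    -- Division by x_i - x_j of f - f[x_i := x_j]; it inverts multiplication
    -- by x_i - x_j.
    module Cancel {i j : Fin n} (i≢j : i ≢ j) where

      d = var i - var j

      σ t : Fin n → Poly
      σ k = assign (k ≟ i) (var j) (var k)
      t k = assign (k ≟ i) 1# 0#

      d*t : ∀ k → d :* t k ≈ₚ var k - σ k
      d*t k with k ≟ i
      ... | yes ≡.refl = *-identityʳ _
      ... | no _       = trans (zeroʳ _) (sym (-‿inverseʳ _))

      open Division d σ t d*t public

      D = λ f → proj₁ (quotient f)

      D-d* : ∀ f → D (d :* f) ≈ₚ f
      D-d* f = begin
        D d :* f :+ d [ σ ] :* D f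
          ≈⟨ +-cong
               (*-congʳ (trans (+-cong (reflexive (assign-yes (i ≟ i) 1# 0#))
                  (trans (-‿cong (reflexive (assign-no (λ p → i≢j (≡.sym p)) (j ≟ i) 1# 0#))) -0#≈0#))
                  (+-identityʳ _)))
               (*-congʳ (trans (+-cong (reflexive (assign-yes (i ≟ i) (var j) (var i)))
                  (-‿cong (reflexive (assign-no (λ p → i≢j (≡.sym p)) (j ≟ i) (var j) (var j)))))
                  (-‿inverseʳ _))) ⟩
        1# :* f :+ 0# :* D f
          ≈⟨ +-cong (*-identityˡ f) (zeroˡ _) ⟩
        f :+ 0#
          ≈⟨ +-identityʳ f ⟩
        f ∎

  -- x_i - x_j is not a zero divisor, so quotients by it are unique.
  [xᵢ-xⱼ]-cancelˡ : ∀ {i j} → i ≢ j → ∀ f g →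
    (var i - var j) :* f ≈ₚ (var i - var j) :* g → f ≈ₚ g
  [xᵢ-xⱼ]-cancelˡ i≢j f g p =
    trans (sym (D-d* f)) (trans (quotient-cong p) (D-d* g))
    where open Cancel i≢j

  swap : Fin n → Fin n → Poly → Poly
  swap i j f = f [ (λ k → var (transpose i j k)) ]

  swap-cong : ∀ i j {f g} → f ≈ₚ g → swap i j f ≈ₚ swap i j g
  swap-cong i j = []-cong _

  private
    module Swap (i j : Fin n) where

      t : Fin n → Poly
      t k = assign (k ≟ i) 1# (assign (k ≟ j) (:- 1#) 0#)

      d*t : ∀ k → (var i - var j) :* t k ≈ₚ var k - var (transpose i j k)
      d*t k with k ≟ i
      ... | yes ≡.refl = *-identityʳ _
      ... | no _ with k ≟ j
      ...   | yes ≡.refl = begin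
        (var i - var j) :* :- 1#       ≈⟨ sym (-‿distribʳ-* _ _) ⟩
        :- ((var i - var j) :* 1#)     ≈⟨ -‿cong (*-identityʳ _) ⟩
        :- (var i - var j)             ≈⟨ sym (-‿+-comm _ _) ⟩
        :- var i :+ :- (:- var j)      ≈⟨ +-congˡ (RingProperties.-‿involutive ring _) ⟩
        :- var i :+ var j              ≈⟨ +-comm _ _ ⟩
        var j - var i                  ∎
      ...   | no _ = trans (zeroʳ _) (sym (-‿inverseʳ _))

  dividedDifference : ∀ i j f → ∃[ q ] (var i - var j) :* q ≈ₚ f - swap i j f
  dividedDifference i j = Division.quotient _ _ _ (Swap.d*t i j)

  dividedDifference-cong : ∀ i j {f g} → f ≈ₚ g →
    proj₁ (dividedDifference i j f) ≈ₚ proj₁ (dividedDifference i j g)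
  dividedDifference-cong i j = Division.quotient-cong _ _ _ (Swap.d*t i j)

------------------------------------------------------------------------
-- Operators on K[x₁,…,xₙ].  The index i ∈ {1,…,n-1} is represented by
-- Fin (pred n), and the variables xᵢ, xᵢ₊₁ by `left i`, `right i`.

left right : ∀ {n} → Fin (pred n) → Fin n
left  {suc _} i = inject₁ i
right {suc _} i = suc i

left≢right : ∀ {n} (i : Fin (pred n)) → left {n} i ≢ right {n} i
left≢right {suc _} i p =
  1+n≢n (≡.sym (≡.trans (≡.sym (toℕ-inject₁ i)) (≡.cong toℕ p)))

module Operators {c ℓ₁ ℓ₂} (K : HeytingField c ℓ₁ ℓ₂) (n : ℕ) where

  private module K = HeytingField K

  open Polynomials (HeytingCommutativeRing.commutativeRing K.heytingCommutativeRing) n public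
    using (Poly; con; var; polynomialRing; swap; swap-cong; [xᵢ-xⱼ]-cancelˡ
          ; dividedDifference; dividedDifference-cong)

  open CommutativeRing polynomialRing

  Index : Set
  Index = Fin (pred n)

  Operator : Set _
  Operator = Func setoid setoid

  xᵢ xᵢ₊₁ : Index → Poly
  xᵢ   i = var (left i)
  xᵢ₊₁ i = var (right i)

  s : Index → Operator
  s i = record { to = swap (left i) (right i) ; cong = swap-cong (left i) (right i) }

  ∂ : Index → Operator
  ∂ i = record
    { to   = λ f → proj₁ (dividedDifference (left i) (right i) f)
    ; cong = dividedDifference-cong (left i) (right i)
    }

  ∂-spec : ∀ i f → (xᵢ i - xᵢ₊₁ i) * (∂ i ⟨$⟩ f) ≈ f - (s i ⟨$⟩ f)
  ∂-spec i f = proj₂ (dividedDifference (left i) (right i) f)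

  ∂-unique : ∀ i f g → (xᵢ i - xᵢ₊₁ i) * g ≈ f - (s i ⟨$⟩ f) → g ≈ ∂ i ⟨$⟩ f
  ∂-unique i f g p =
    [xᵢ-xⱼ]-cancelˡ (left≢right i) g (∂ i ⟨$⟩ f) (trans p (sym (∂-spec i f)))

  record Triple : Set c where
    constructor ⟨_,_,_⟩
    field P⁺ Q₊ R₊ : Poly

  π : Index → Triple → Operator
  π i ⟨ P⁺ , Q₊ , R₊ ⟩ = record
    { to   = λ f → (∂ i ⟨$⟩ (P⁺ * f)) + Q₊ * (∂ i ⟨$⟩ f) + R₊ * f
    ; cong = λ p → +-cong (+-cong (Func.cong (∂ i) (*-congˡ {P⁺} p)) (*-congˡ (Func.cong (∂ i) p)))
                     (*-congˡ p)
    }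

  record GenerateHecke (T : Index → Operator) (μ ν : K.Carrier) : Set (c ⊔ ℓ₁) where
    field
      commute   : ∀ i k → 2 ≤ ∣ toℕ k - toℕ i ∣ → ∀ f →
                  T i ⟨$⟩ (T k ⟨$⟩ f) ≈ T k ⟨$⟩ (T i ⟨$⟩ f)
      braid     : ∀ i k → toℕ k ≡ suc (toℕ i) → ∀ f →
                  T i ⟨$⟩ (T k ⟨$⟩ (T i ⟨$⟩ f)) ≈ T k ⟨$⟩ (T i ⟨$⟩ (T k ⟨$⟩ f))
      quadratic : ∀ i f →
                  T i ⟨$⟩ (T i ⟨$⟩ f) ≈ con μ * (T i ⟨$⟩ f) + con ν * f

  module _ (a b c d : K.Carrier) where

    triple₁ : (e : K.Carrier) → Index → Triple
    triple₁ e i =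
      ⟨ con a * xᵢ i * xᵢ₊₁ i + con (b K.- e) * xᵢ i + con c * xᵢ₊₁ i + con d
      , con e * xᵢ i
      , 0# ⟩

    triple₂ : Fin 4 → Index → Triple
    triple₂ 0F i =
      ⟨ con a * xᵢ i * xᵢ₊₁ i + con b * xᵢ i + con c * xᵢ₊₁ i + con d
      , 0#
      , 0# ⟩
    triple₂ 1F i =
      ⟨ con a * xᵢ i * xᵢ₊₁ i + con c * xᵢ i + con c * xᵢ₊₁ i + con d
      , con (b K.- c) * xᵢ i
      , 0# ⟩
    triple₂ 2F i =
      ⟨ con a * (xᵢ i * xᵢ i) + con (b K.+ c) * xᵢ i + con c * xᵢ₊₁ i + con d
      , - (con c * xᵢ i)
      , - (con a * xᵢ i) ⟩
    triple₂ 3F i =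
      ⟨ con c * xᵢ₊₁ i + con d
      , con a * (xᵢ i * xᵢ i) + con b * xᵢ i
      , - (con a * xᵢ i) ⟩

{-# OPTIONS --safe #-}
module Submission where

-- Write x = xᵢ, y = xᵢ₊₁ and A(u,v) = a u v + b u + c v + d.  In every case
-- πᵢ f = (A(x,y) f − B(x,y) sᵢ f) / (x − y), where B(x,y) is
-- A(y,x) + e (x − y) in case (1) and A(y,x), A(x,y), A(y,y), A(x,x) for
-- the four triples of case (2).  As ad = bc, the 2×2 minors
-- A(u,v) A(w,t) − A(u,t) A(w,v) vanish.  Hence
-- B(u,v) B(v,u) = A(u,v) A(v,u) − ν (u − v)², which gives the quadratic
-- relation.  Once πᵢ πᵢ₊₁ πᵢ f is expanded in the six images of f under S₃,
-- the vanishing minors turn its coefficients into expressions that are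
-- symmetric under exchanging πᵢ and πᵢ₊₁.

open import Defs
open import Algebra.Apartness.Bundles using (HeytingField; HeytingCommutativeRing)
open import Algebra.Bundles using (CommutativeRing; RawRing)
import Algebra.Properties.Ring as RingProperties
import Algebra.Properties.Semiring.Mult as SemiringMult
import Algebra.Solver.Ring as RingSolver
import Algebra.Solver.Ring.NaturalCoefficients.Default as SemiringSolver
open import Algebra.Solver.Ring.AlmostCommutativeRing using (fromCommutativeRing; _-Raw-AlmostCommutative⟶_)
open import Data.Bool.Base using (Bool; true; false)
open import Data.Fin.Base using (Fin; toℕ)
open import Data.Fin.Patterns using (0F; 1F; 2F; 3F)
open import Data.Fin.Permutation.Components using (transpose; transpose-inverse)
open import Data.Fin.Properties using (_≟_; toℕ-inject₁; toℕ-injective)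
open import Data.Maybe.Base using (Maybe; just; nothing)
open import Data.Nat.Base as ℕ using (ℕ; pred) renaming (_≤_ to _≤ℕ_)
import Data.Nat.Properties as ℕ
open import Data.Product.Base using (_×_; _,_)
open import Function.Base using (_∘_)
open import Function.Bundles using (_⟨$⟩_)
open import Level using (0ℓ; _⊔_)
open import Relation.Binary.PropositionalEquality as ≡ using (_≡_; _≢_; _≗_)
import Relation.Binary.Reasoning.Setoid as SetoidReasoning
open import Relation.Nullary.Decidable using (Dec; yes; no; dec-true; dec-false)
open import Relation.Nullary.Negation using (¬_; contradiction)

-- The ring solver with integer coefficients; (m , n) stands for m − n.
module IntegerSolver {c ℓ} (R : CommutativeRing c ℓ) where

  open CommutativeRing R
  open RingProperties ring using (-‿distribˡ-*; -‿distribʳ-*; -‿+-comm; -‿involutive; -0#≈0#)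
  open SemiringMult semiring using (×-homo-+; ×1-homo-*; ×-congˡ) renaming (_×_ to _·_)
  open SetoidReasoning setoid
  private module S = SemiringSolver commutativeSemiring

  differences : RawRing 0ℓ 0ℓ
  differences = record
    { Carrier = ℕ × ℕ
    ; _≈_     = _≡_
    ; _+_     = λ (m , n) (m′ , n′) → m ℕ.+ m′ , n ℕ.+ n′
    ; _*_     = λ (m , n) (m′ , n′) → m ℕ.* m′ ℕ.+ n ℕ.* n′ , m ℕ.* n′ ℕ.+ n ℕ.* m′
    ; -_      = λ (m , n) → n , m
    ; 0#      = 0 , 0
    ; 1#      = 1 , 0
    }

  private
    ⟦_⟧ : ℕ × ℕ → Carrier
    ⟦ m , n ⟧ = m · 1# - n · 1#

    -- The semiring solver knows no negation, so here and in the product rule below the negated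
    -- elements are passed to it as atoms, after the signs have been moved onto them.
    [w-x]+[y-z] : ∀ w x y z → (w + y) - (x + z) ≈ (w - x) + (y - z)
    [w-x]+[y-z] w x y z = trans (+-congˡ (sym (-‿+-comm x z)))
      (S.solve 4 (λ w x y z → (w S.:+ y) S.:+ (x S.:+ z) S.:= (w S.:+ x) S.:+ (y S.:+ z))
        refl w (- x) y (- z))

    [w-x]*[y-z] : ∀ w x y z → (w * y + x * z) - (w * z + x * y) ≈ (w - x) * (y - z)
    [w-x]*[y-z] w x y z = begin
      (w * y + x * z) - (w * z + x * y)
        ≈⟨ +-cong
             (+-congˡ (trans (sym (-‿involutive _))
               (trans (-‿cong (-‿distribˡ-* x z)) (-‿distribʳ-* (- x) z))))
             (trans (sym (-‿+-comm _ _)) (+-cong (-‿distribʳ-* w z) (-‿distribˡ-* x y))) ⟩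
      (w * y + - x * - z) + (w * - z + - x * y)
        ≈⟨ S.solve 4 (λ w x y z →
             (w S.:* y S.:+ x S.:* z) S.:+ (w S.:* z S.:+ x S.:* y)
             S.:= (w S.:+ x) S.:* (y S.:+ z))
             refl w (- x) y (- z) ⟩
      (w - x) * (y - z) ∎

    homomorphism : differences -Raw-AlmostCommutative⟶ fromCommutativeRing R
    homomorphism = record
      { ⟦_⟧    = ⟦_⟧
      ; +-homo = λ (m , n) (m′ , n′) →
          trans (+-cong (×-homo-+ 1# m m′) (-‿cong (×-homo-+ 1# n n′))) ([w-x]+[y-z] _ _ _ _)
      ; *-homo = λ (m , n) (m′ , n′) →
          trans (+-cong (sum-homo m m′ n n′) (-‿cong (sum-homo m n′ n m′))) ([w-x]*[y-z] _ _ _ _)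
      ; -‿homo = λ (m , n) →
          trans (+-congʳ (sym (-‿involutive _))) (trans (-‿+-comm _ _) (-‿cong (+-comm _ _)))
      ; 0-homo = -‿inverseʳ 0#
      ; 1-homo = trans (+-cong (+-identityʳ 1#) -0#≈0#) (+-identityʳ 1#)
      }
      where
      sum-homo : ∀ k l m n → (k ℕ.* l ℕ.+ m ℕ.* n) · 1# ≈ (k · 1#) * (l · 1#) + (m · 1#) * (n · 1#)
      sum-homo k l m n =
        trans (×-homo-+ 1# (k ℕ.* l) (m ℕ.* n)) (+-cong (×1-homo-* k l) (×1-homo-* m n))

    -- Pairs are not normalised, so equality of the represented integers is tested as
    -- `m + n′ ≡ m′ + n`. Adding `n′ − n′` to the first value produces the sum `m + n′` to which
    -- this equation applies.
    _≟?_ : ∀ p q → Maybe (⟦ p ⟧ ≈ ⟦ q ⟧)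
    (m , n) ≟? (m′ , n′) with m ℕ.+ n′ ℕ.≟ m′ ℕ.+ n
    ... | no _  = nothing
    ... | yes p = just (begin
      m · 1# - n · 1#
        ≈⟨ +-identityʳ _ ⟨
      (m · 1# - n · 1#) + 0#
        ≈⟨ +-congˡ (-‿inverseʳ (n′ · 1#)) ⟨
      (m · 1# - n · 1#) + (n′ · 1# - n′ · 1#)
        ≈⟨ S.solve 4 (λ m n k l → (m S.:+ n) S.:+ (k S.:+ l) S.:= (m S.:+ k) S.:+ (n S.:+ l))
             refl _ _ _ _ ⟩
      (m · 1# + n′ · 1#) + (- (n · 1#) - n′ · 1#)
        ≈⟨ +-congʳ (trans (sym (×-homo-+ 1# m n′)) (trans (×-congˡ p) (×-homo-+ 1# m′ n))) ⟩
      (m′ · 1# + n · 1#) + (- (n · 1#) - n′ · 1#)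
        ≈⟨ S.solve 4 (λ m n k l → (m S.:+ n) S.:+ (k S.:+ l) S.:= (m S.:+ l) S.:+ (n S.:+ k))
             refl _ _ _ _ ⟩
      (m′ · 1# - n′ · 1#) + (n · 1# - n · 1#)
        ≈⟨ +-congˡ (-‿inverseʳ (n · 1#)) ⟩
      (m′ · 1# - n′ · 1#) + 0#
        ≈⟨ +-identityʳ _ ⟩
      m′ · 1# - n′ · 1# ∎)

  open RingSolver differences (fromCommutativeRing R) homomorphism _≟?_ public
    using (solve; _:=_; _:+_; _:*_; _:-_; :-_)

-- Expansion of a threefold composite over the six permutations of three variables.

module BraidAlgebra {c ℓ} (R : CommutativeRing c ℓ) where

  open CommutativeRing R
  open SetoidReasoning setoid
  open IntegerSolver R

  sub-cong : ∀ {x x′ y y′} → x ≈ x′ → y ≈ y′ → x - y ≈ x′ - y′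
  sub-cong p q = +-cong p (-‿cong q)

  -- With s = sᵢ, t = sᵢ₊₁ this computes w = πᵢ πᵢ₊₁ πᵢ f from u = πᵢ f and
  -- v = πᵢ₊₁ u; letters such as stf and su stand for the image of f or u.
  -- Here p = x − y, q = y − z, r = x − z, but the roles of (s, p) and (t, q)
  -- may be exchanged to compute πᵢ₊₁ πᵢ πᵢ₊₁ f.
  expand-braid : ∀ {α α′ α″ ᾱ β β̄ β′ β″ γ′ γ″ ν p q r f sf tf stf tsf stsf u su tu stu v sv w} →
    p * w   ≈ α * v - β * sv →
    q * v   ≈ α′ * u - γ′ * tu →
    r * sv  ≈ α″ * su - γ″ * stu →
    p * u   ≈ α * f - β * sf →
    p * su  ≈ β̄ * f - ᾱ * sf →
    r * tu  ≈ α″ * tf - β″ * tsf →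
    q * stu ≈ α′ * stf - β′ * stsf →
    β * β̄ ≈ α * ᾱ - ν * (p * p) →
    α * α′ * r ≈ ᾱ * α″ * q + α″ * α′ * p →
    p * (p * q * r * w) ≈
      p * ((α * α′ * α″ + ν * p * q * α″) * f - β * α′ * α″ * sf - α * γ′ * α″ * tf
           + α * γ′ * β″ * tsf + β * γ″ * α′ * stf - β * γ″ * β′ * stsf)
  expand-braid {α} {α′} {α″} {ᾱ} {β} {β̄} {β′} {β″} {γ′} {γ″} {ν} {p} {q} {r} {f} {sf} {tf} {stf} {tsf} {stsf}
    {u} {su} {tu} {stu} {v} {sv} {w} pw qv rsv pu psu rtu qstu ββ̄ αα′r = begin
    p * (p * q * r * w)
      ≈⟨ solve 4 (λ p q r w → p :* (p :* q :* r :* w) := p :* q :* r :* (p :* w)) refl p q r w ⟩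
    p * q * r * (p * w)
      ≈⟨ *-congˡ pw ⟩
    p * q * r * (α * v - β * sv)
      ≈⟨ solve 7 (λ p q r α β v sv → p :* q :* r :* (α :* v :- β :* sv)
           := p :* r :* α :* (q :* v) :- p :* q :* β :* (r :* sv)) refl p q r α β v sv ⟩
    p * r * α * (q * v) - p * q * β * (r * sv)
      ≈⟨ sub-cong (*-congˡ qv) (*-congˡ rsv) ⟩
    p * r * α * (α′ * u - γ′ * tu) - p * q * β * (α″ * su - γ″ * stu)
      ≈⟨ sub-cong
           (solve 7 (λ p r α α′ γ′ u tu → p :* r :* α :* (α′ :* u :- γ′ :* tu)
             := α :* α′ :* r :* (p :* u) :- p :* α :* γ′ :* (r :* tu)) refl p r α α′ γ′ u tu)
           (solve 7 (λ p q β α″ γ″ su stu → p :* q :* β :* (α″ :* su :- γ″ :* stu)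
             := q :* β :* α″ :* (p :* su) :- p :* β :* γ″ :* (q :* stu)) refl p q β α″ γ″ su stu) ⟩
    (α * α′ * r * (p * u) - p * α * γ′ * (r * tu)) - (q * β * α″ * (p * su) - p * β * γ″ * (q * stu))
      ≈⟨ sub-cong (sub-cong (*-cong αα′r pu) (*-congˡ rtu)) (sub-cong (*-congˡ psu) (*-congˡ qstu)) ⟩
    ((ᾱ * α″ * q + α″ * α′ * p) * (α * f - β * sf) - p * α * γ′ * (α″ * tf - β″ * tsf))
      - (q * β * α″ * (β̄ * f - ᾱ * sf) - p * β * γ″ * (α′ * stf - β′ * stsf))
      -- The `sf` terms carrying the factor `q` cancel. What remains with the factor `q` contains
      -- `α * ᾱ - β * β̄`, which the next step turns into `ν * (p * p)`, so that `p` becomes a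
      -- factor of the whole expression.
      ≈⟨ solve 12 (λ ᾱ α″ α′ p q α β β̄ f sf X Y →
           ((ᾱ :* α″ :* q :+ α″ :* α′ :* p) :* (α :* f :- β :* sf) :- X)
             :- (q :* β :* α″ :* (β̄ :* f :- ᾱ :* sf) :- Y)
           := (α″ :* q :* (α :* ᾱ :- β :* β̄) :* f :+ p :* (α :* α′ :* α″ :* f :- β :* α′ :* α″ :* sf))
               :- (X :- Y))
           refl ᾱ α″ α′ p q α β β̄ f sf _ _ ⟩
    (α″ * q * (α * ᾱ - β * β̄) * f + p * (α * α′ * α″ * f - β * α′ * α″ * sf))
      - (p * α * γ′ * (α″ * tf - β″ * tsf) - p * β * γ″ * (α′ * stf - β′ * stsf))
      ≈⟨ +-congʳ (+-congʳ (*-congʳ (*-congˡ (sub-cong refl ββ̄)))) ⟩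
    (α″ * q * (α * ᾱ - (α * ᾱ - ν * (p * p))) * f + p * (α * α′ * α″ * f - β * α′ * α″ * sf))
      - (p * α * γ′ * (α″ * tf - β″ * tsf) - p * β * γ″ * (α′ * stf - β′ * stsf))
      ≈⟨ sub-cong
           (solve 10 (λ α″ q α ᾱ ν p α′ β f sf →
             α″ :* q :* (α :* ᾱ :- (α :* ᾱ :- ν :* (p :* p))) :* f
               :+ p :* (α :* α′ :* α″ :* f :- β :* α′ :* α″ :* sf)
             := p :* ((α :* α′ :* α″ :+ ν :* p :* q :* α″) :* f :- β :* α′ :* α″ :* sf))
             refl α″ q α ᾱ ν p α′ β f sf)
           (solve 13 (λ p α γ′ α″ β″ β γ″ α′ β′ tf tsf stf stsf →
             p :* α :* γ′ :* (α″ :* tf :- β″ :* tsf) :- p :* β :* γ″ :* (α′ :* stf :- β′ :* stsf)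
             := p :* (α :* γ′ :* α″ :* tf :- α :* γ′ :* β″ :* tsf
                      :- β :* γ″ :* α′ :* stf :+ β :* γ″ :* β′ :* stsf))
             refl p α γ′ α″ β″ β γ″ α′ β′ tf tsf stf stsf) ⟩
    p * ((α * α′ * α″ + ν * p * q * α″) * f - β * α′ * α″ * sf)
      - p * (α * γ′ * α″ * tf - α * γ′ * β″ * tsf - β * γ″ * α′ * stf + β * γ″ * β′ * stsf)
      ≈⟨ solve 7 (λ p F S T U V W → p :* (F :- S) :- p :* (T :- U :- V :+ W)
           := p :* (F :- S :- T :+ U :+ V :- W)) refl p _ _ _ _ _ _ ⟩
    p * ((α * α′ * α″ + ν * p * q * α″) * f - β * α′ * α″ * sf - α * γ′ * α″ * tf
         + α * γ′ * β″ * tsf + β * γ″ * α′ * stf - β * γ″ * β′ * stsf) ∎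

-- Relations between transpositions of indices.

module _ {n : ℕ} where

  transpose-matchˡ : ∀ (i j : Fin n) → transpose i j i ≡ j
  transpose-matchˡ i j rewrite dec-true (i ≟ i) ≡.refl = ≡.refl

  transpose-matchʳ : ∀ (i j : Fin n) → transpose i j j ≡ i
  transpose-matchʳ i j with j ≟ i
  ... | yes j≡i = j≡i
  ... | no _ rewrite dec-true (j ≟ j) ≡.refl = ≡.refl

  transpose-other : ∀ {i j k : Fin n} → k ≢ i → k ≢ j → transpose i j k ≡ k
  transpose-other {i} {j} {k} k≢i k≢j
    rewrite dec-false (k ≟ i) k≢i | dec-false (k ≟ j) k≢j = ≡.refl

  -- Bridges to `transpose-inverse`, which composes `transpose i j` with `transpose j i`; this gives
  -- involutivity below.
  transpose-comm : ∀ (i j : Fin n) → transpose i j ≗ transpose j i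
  transpose-comm i j k = go (k ≟ i) (k ≟ j)
    where
    go : Dec (k ≡ i) → Dec (k ≡ j) → transpose i j k ≡ transpose j i k
    go (yes ≡.refl) _            = ≡.trans (transpose-matchˡ i j) (≡.sym (transpose-matchʳ j i))
    go (no _)       (yes ≡.refl) = ≡.trans (transpose-matchʳ i j) (≡.sym (transpose-matchˡ j i))
    go (no k≢i)     (no k≢j)     =
      ≡.trans (transpose-other k≢i k≢j) (≡.sym (transpose-other k≢j k≢i))

  transpose-involutive : ∀ (i j : Fin n) k → transpose i j (transpose i j k) ≡ k
  transpose-involutive i j k =
    ≡.trans (≡.cong (transpose i j) (transpose-comm i j k)) (transpose-inverse i j)

  transpose-commute : ∀ {i j k l : Fin n} → i ≢ k → i ≢ l → j ≢ k → j ≢ l →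
    transpose i j ∘ transpose k l ≗ transpose k l ∘ transpose i j
  transpose-commute {i} {j} {k} {l} i≢k i≢l j≢k j≢l m = go (m ≟ i) (m ≟ j) (m ≟ k) (m ≟ l)
    where
    go : Dec (m ≡ i) → Dec (m ≡ j) → Dec (m ≡ k) → Dec (m ≡ l) →
      transpose i j (transpose k l m) ≡ transpose k l (transpose i j m)
    go (yes ≡.refl) _ _ _
      rewrite transpose-other i≢k i≢l | transpose-matchˡ i j = ≡.sym (transpose-other j≢k j≢l)
    go (no _) (yes ≡.refl) _ _
      rewrite transpose-other j≢k j≢l | transpose-matchʳ i j = ≡.sym (transpose-other i≢k i≢l)
    go (no m≢i) (no m≢j) (yes ≡.refl) _
      rewrite transpose-other m≢i m≢j | transpose-matchˡ k l
            = transpose-other (≡.≢-sym i≢l) (≡.≢-sym j≢l)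
    go (no m≢i) (no m≢j) (no _) (yes ≡.refl)
      rewrite transpose-other m≢i m≢j | transpose-matchʳ k l
            = transpose-other (≡.≢-sym i≢k) (≡.≢-sym j≢k)
    go (no m≢i) (no m≢j) (no m≢k) (no m≢l)
      rewrite transpose-other m≢i m≢j | transpose-other m≢k m≢l = transpose-other m≢i m≢j

  -- Both composites are the transposition of `i` and `k`.
  transpose-braid : ∀ {i j k : Fin n} → i ≢ j → j ≢ k → i ≢ k →
    transpose i j ∘ transpose j k ∘ transpose i j ≗ transpose j k ∘ transpose i j ∘ transpose j k
  transpose-braid {i} {j} {k} i≢j j≢k i≢k l = go (l ≟ i) (l ≟ j) (l ≟ k)
    where
    k≢i = ≡.≢-sym i≢k
    k≢j = ≡.≢-sym j≢k
    go : Dec (l ≡ i) → Dec (l ≡ j) → Dec (l ≡ k) →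
      transpose i j (transpose j k (transpose i j l)) ≡ transpose j k (transpose i j (transpose j k l))
    go (yes ≡.refl) _ _
      rewrite transpose-other i≢j i≢k | transpose-matchˡ i j | transpose-matchˡ j k
            = transpose-other k≢i k≢j
    go (no _) (yes ≡.refl) _
      rewrite transpose-matchʳ i j | transpose-other i≢j i≢k | transpose-matchˡ i j
            | transpose-matchˡ j k | transpose-other k≢i k≢j = ≡.sym (transpose-matchʳ j k)
    go (no _) (no _) (yes ≡.refl)
      rewrite transpose-other k≢i k≢j | transpose-matchʳ j k | transpose-matchʳ i j
            = ≡.sym (transpose-other i≢j i≢k)
    go (no l≢i) (no l≢j) (no l≢k)
      rewrite transpose-other l≢i l≢j | transpose-other l≢j l≢k | transpose-other l≢i l≢j
            = ≡.sym (transpose-other l≢j l≢k)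

-- The symmetric group acting on polynomial terms by renaming variables.

module Substitution {c ℓ} (K : CommutativeRing c ℓ) (n : ℕ) where

  open Polynomials K n
  open CommutativeRing polynomialRing using (reflexive)

  rename : (Fin n → Fin n) → Poly → Poly
  rename ρ f = f [ var ∘ ρ ]

  -- Renaming acts on terms and leaves their shape unchanged, so structural induction yields
  -- syntactic equality, which is stronger than `≈ₚ`.
  rename-∘ : ∀ ρ τ f → rename ρ (rename τ f) ≡ rename (ρ ∘ τ) f
  rename-∘ ρ τ (con a)  = ≡.refl
  rename-∘ ρ τ (var k)  = ≡.refl
  rename-∘ ρ τ (f :+ g) = ≡.cong₂ _:+_ (rename-∘ ρ τ f) (rename-∘ ρ τ g)
  rename-∘ ρ τ (f :* g) = ≡.cong₂ _:*_ (rename-∘ ρ τ f) (rename-∘ ρ τ g)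
  rename-∘ ρ τ (:- f)   = ≡.cong :-_ (rename-∘ ρ τ f)

  rename-≗ : ∀ {ρ τ} → ρ ≗ τ → ∀ f → rename ρ f ≡ rename τ f
  rename-≗ ρ≗τ (con a)  = ≡.refl
  rename-≗ ρ≗τ (var k)  = ≡.cong var (ρ≗τ k)
  rename-≗ ρ≗τ (f :+ g) = ≡.cong₂ _:+_ (rename-≗ ρ≗τ f) (rename-≗ ρ≗τ g)
  rename-≗ ρ≗τ (f :* g) = ≡.cong₂ _:*_ (rename-≗ ρ≗τ f) (rename-≗ ρ≗τ g)
  rename-≗ ρ≗τ (:- f)   = ≡.cong :-_ (rename-≗ ρ≗τ f)

  rename-id : ∀ f → rename (λ k → k) f ≡ f
  rename-id (con a)  = ≡.refl
  rename-id (var k)  = ≡.refl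
  rename-id (f :+ g) = ≡.cong₂ _:+_ (rename-id f) (rename-id g)
  rename-id (f :* g) = ≡.cong₂ _:*_ (rename-id f) (rename-id g)
  rename-id (:- f)   = ≡.cong :-_ (rename-id f)

  swap-involutive : ∀ i j f → swap i j (swap i j f) ≈ₚ f
  swap-involutive i j f = reflexive (≡.trans (rename-∘ _ _ f)
    (≡.trans (rename-≗ (transpose-involutive i j) f) (rename-id f)))

  swap-commute : ∀ {i j k l} → i ≢ k → i ≢ l → j ≢ k → j ≢ l → ∀ f →
    swap i j (swap k l f) ≈ₚ swap k l (swap i j f)
  swap-commute i≢k i≢l j≢k j≢l f = reflexive (≡.trans (rename-∘ _ _ f)
    (≡.trans (rename-≗ (transpose-commute i≢k i≢l j≢k j≢l) f) (≡.sym (rename-∘ _ _ f))))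

  swap-braid : ∀ {i j k} → i ≢ j → j ≢ k → i ≢ k → ∀ f →
    swap i j (swap j k (swap i j f)) ≈ₚ swap j k (swap i j (swap j k f))
  swap-braid i≢j j≢k i≢k f = reflexive (≡.trans (rename-∘₃ _ _ _)
    (≡.trans (rename-≗ (transpose-braid i≢j j≢k i≢k) f) (≡.sym (rename-∘₃ _ _ _))))
    where
    rename-∘₃ : ∀ ρ τ υ → rename ρ (rename τ (rename υ f)) ≡ rename (ρ ∘ τ ∘ υ) f
    rename-∘₃ ρ τ υ = ≡.trans (≡.cong (rename ρ) (rename-∘ τ υ f)) (rename-∘ ρ (τ ∘ υ) f)

-- Operators of the form (A f - B sᵢ f) / (xᵢ - xᵢ₊₁) when ad = bc.

ZeroDeterminant : ∀ {κ ℓ} (K : CommutativeRing κ ℓ) → let open CommutativeRing K in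
  (a b c d : Carrier) → Set ℓ
ZeroDeterminant K a b c d = a * d - b * c ≈ 0#
  where open CommutativeRing K

module DividedOperators {κ ℓ} (K : CommutativeRing κ ℓ) (n : ℕ)
  (a b c d : CommutativeRing.Carrier K) (ad-bc≈0 : ZeroDeterminant K a b c d)
  where

  open CommutativeRing K using () renaming (Carrier to F; _-_ to _-ᴷ_; 0# to 0ᴷ)

  open Polynomials K n using (Poly; con; var; con-+; con-*; con-cong; swap; swap-cong; polynomialRing
    ; [xᵢ-xⱼ]-cancelˡ)
  open Substitution K n
  open CommutativeRing polynomialRing hiding (_≉_)
  open RingProperties ring using (+-cancelˡ)
  open SetoidReasoning setoid
  open IntegerSolver polynomialRing
  open BraidAlgebra polynomialRing

  -- The presentation of the polynomial ring gives `con-+` and `con-*` but no rule for negation;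
  -- that one follows by cancelling `con y`.
  con-- : ∀ x y → con (x -ᴷ y) ≈ con x - con y
  con-- x y = trans (con-+ _ _) (+-congˡ (+-cancelˡ (con y) _ _ (begin
    con y + con (CommutativeRing.-_ K y) ≈⟨ con-+ _ _ ⟨
    con (y -ᴷ y)                         ≈⟨ con-cong (CommutativeRing.-‿inverseʳ K y) ⟩
    con 0ᴷ                               ≈⟨ -‿inverseʳ _ ⟨
    con y - con y                        ∎)))

  A : Poly → Poly → Poly
  A u v = con a * u * v + con b * u + con c * v + con d

  -- The division-free form of A u v being a product of a function of u and
  -- a function of v.
  A-rank1 : ∀ u v w t → A u v * A w t ≈ A u t * A w v
  A-rank1 u v w t = begin
    A u v * A w t
      -- For arbitrary a, b, c, d the minor A(u,v) A(w,t) - A(u,t) A(w,v) equals (ad - bc)(u - w)(v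
      -- - t).
      ≈⟨ solve 8 (λ a b c d u v w t →
           (a :* u :* v :+ b :* u :+ c :* v :+ d) :* (a :* w :* t :+ b :* w :+ c :* t :+ d)
           := (a :* u :* t :+ b :* u :+ c :* t :+ d) :* (a :* w :* v :+ b :* w :+ c :* v :+ d)
              :+ (a :* d :- b :* c) :* ((u :- w) :* (v :- t)))
           refl (con a) (con b) (con c) (con d) u v w t ⟩
    A u t * A w v + (con a * con d - con b * con c) * ((u - w) * (v - t))
      ≈⟨ +-congˡ (trans (*-congʳ con-ad-bc≈0) (zeroˡ _)) ⟩
    A u t * A w v + 0#
      ≈⟨ +-identityʳ _ ⟩
    A u t * A w v ∎
    where
    con-ad-bc≈0 : con a * con d - con b * con c ≈ 0#
    con-ad-bc≈0 = trans (sub-cong (sym (con-* a d)) (sym (con-* b c)))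
      (trans (sym (con-- _ _)) (con-cong ad-bc≈0))

  -- A vanishing minor replaces A(x,y) A(y,z) by A(x,z) A(y,y). As v ↦ A(y,v) is affine,
  -- interpolating between x and z gives (x - z) A(y,y) = (y - z) A(y,x) + (x - y) A(y,z).
  A-braidˡ : ∀ x y z → A x y * A y z * (x - z) ≈ A y x * A x z * (y - z) + A x z * A y z * (x - y)
  A-braidˡ x y z = begin
    A x y * A y z * (x - z)
      ≈⟨ *-congʳ (A-rank1 x y y z) ⟩
    A x z * A y y * (x - z)
      ≈⟨ solve 8 (λ a b c d x y z B →
           B :* (a :* y :* y :+ b :* y :+ c :* y :+ d) :* (x :- z)
           := (a :* y :* x :+ b :* y :+ c :* x :+ d) :* B :* (y :- z)
              :+ B :* (a :* y :* z :+ b :* y :+ c :* z :+ d) :* (x :- y))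
           refl (con a) (con b) (con c) (con d) x y z (A x z) ⟩
    A y x * A x z * (y - z) + A x z * A y z * (x - y) ∎

  -- The mirror image, with interpolation of the affine map u ↦ A(u,y) between x and z.
  A-braidʳ : ∀ x y z → A y z * A x y * (x - z) ≈ A z y * A x z * (x - y) + A x z * A x y * (y - z)
  A-braidʳ x y z = begin
    A y z * A x y * (x - z)
      ≈⟨ *-congʳ (A-rank1 y z x y) ⟩
    A y y * A x z * (x - z)
      ≈⟨ solve 8 (λ a b c d x y z B →
           (a :* y :* y :+ b :* y :+ c :* y :+ d) :* B :* (x :- z)
           := (a :* z :* y :+ b :* z :+ c :* y :+ d) :* B :* (x :- y)
              :+ B :* (a :* x :* y :+ b :* x :+ c :* y :+ d) :* (y :- z))
           refl (con a) (con b) (con c) (con d) x y z (A x z) ⟩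
    A z y * A x z * (x - y) + A x z * A x y * (y - z) ∎

  -- The conditions on B under which (A f - B sᵢ f) / (xᵢ - xᵢ₊₁) satisfies the quadratic relation
  -- with constant term ν. The product in `norm` arises because interchanging the two variables
  -- turns B(u,v) into B(v,u).
  record IsKernel (ν : F) (B : Poly → Poly → Poly) : Set (κ ⊔ ℓ) where
    field
      swap-homo : ∀ i j u v → swap i j (B u v) ≈ B (swap i j u) (swap i j v)
      norm      : ∀ u v → B u v * B v u ≈ A u v * A v u - con ν * ((u - v) * (u - v))

  -- h is to be read as the image of f under the interchange of x_l and x_m,
  -- so that g = (A f − B h) / (x_l − x_m).
  Divided : Fin n → Fin n → (Poly → Poly → Poly) → Poly → Poly → Poly → Set _
  Divided l m B g f h = (var l - var m) * g ≈ A (var l) (var m) * f - B (var l) (var m) * h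

  IsDivided : Fin n → Fin n → (Poly → Poly → Poly) → (Poly → Poly) → Set _
  IsDivided l m B T = ∀ f → Divided l m B (T f) f (swap l m f)

  module _ {ν} {B : Poly → Poly → Poly} (isKernel : IsKernel ν B) where

    open IsKernel isKernel

    -- An interchange of variables is a ring homomorphism, so it may be applied to the equation
    -- `Divided`. The new positions enter through equations because `transpose` at abstract indices
    -- does not reduce.
    Divided-swap : ∀ {i j l m l′ m′ f g h} → transpose i j l ≡ l′ → transpose i j m ≡ m′ →
      Divided l m B g f h → Divided l′ m′ B (swap i j g) (swap i j f) (swap i j h)
    Divided-swap ≡.refl ≡.refl p = trans (swap-cong _ _ p) (sub-cong refl (*-congʳ (swap-homo _ _ _ _)))

    -- Interchanging x_l and x_m in the defining equation negates x_l - x_m and exchanges `f` with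
    -- its image; this explains the reversed order of A and B and of their arguments.
    swap-IsDivided : ∀ {l m T} → IsDivided l m B T → ∀ f →
      (var l - var m) * swap l m (T f) ≈ B (var m) (var l) * f - A (var m) (var l) * swap l m f
    swap-IsDivided {l} {m} {T} T-div f = begin
      (x - y) * swap l m (T f)
        ≈⟨ solve 3 (λ x y g → (x :- y) :* g := :- ((y :- x) :* g)) refl x y _ ⟩
      - ((y - x) * swap l m (T f))
        ≈⟨ -‿cong (Divided-swap (transpose-matchˡ l m) (transpose-matchʳ l m) (T-div f)) ⟩
      - (A y x * swap l m f - B y x * swap l m (swap l m f))
        ≈⟨ -‿cong (sub-cong refl (*-congˡ (swap-involutive l m f))) ⟩
      - (A y x * swap l m f - B y x * f)
        ≈⟨ solve 2 (λ g h → :- (g :- h) := h :- g) refl _ _ ⟩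
      B y x * f - A y x * swap l m f ∎
      where x = var l ; y = var m

    -- After multiplication by p², the square is (α - ᾱ) p T f + (α ᾱ - β β̄) f. Here α - ᾱ = (b -
    -- c) p and α ᾱ - β β̄ = ν p², and p can be cancelled twice.
    IsDivided-quadratic : ∀ {l m T} → l ≢ m → IsDivided l m B T → ∀ f →
      T (T f) ≈ con (b -ᴷ c) * T f + con ν * f
    IsDivided-quadratic {l} {m} {T} l≢m T-div f =
      cancel (cancel (begin
        p * (p * T g)
          ≈⟨ *-congˡ (T-div g) ⟩
        p * (α * g - β * swap l m g)
          ≈⟨ solve 5 (λ p α β g sg → p :* (α :* g :- β :* sg) := α :* (p :* g) :- β :* (p :* sg))
               refl p α β g _ ⟩
        α * (p * g) - β * (p * swap l m g)
          ≈⟨ sub-cong (*-congˡ (T-div f)) (*-congˡ (swap-IsDivided T-div f)) ⟩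
        α * (α * f - β * swap l m f) - β * (β̄ * f - ᾱ * swap l m f)
          ≈⟨ solve 6 (λ α β ᾱ β̄ f sf →
               α :* (α :* f :- β :* sf) :- β :* (β̄ :* f :- ᾱ :* sf)
               := (α :- ᾱ) :* (α :* f :- β :* sf) :+ (α :* ᾱ :- β :* β̄) :* f)
               refl α β ᾱ β̄ f _ ⟩
        (α - ᾱ) * (α * f - β * swap l m f) + (α * ᾱ - β * β̄) * f
          ≈⟨ +-cong (*-cong α-ᾱ (sym (T-div f))) (*-congʳ (sub-cong refl (norm x y))) ⟩
        con (b -ᴷ c) * p * (p * g) + (α * ᾱ - (α * ᾱ - con ν * (p * p))) * f
          ≈⟨ solve 6 (λ μ p g N ν f → μ :* p :* (p :* g) :+ (N :- (N :- ν :* (p :* p))) :* f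
               := p :* (p :* (μ :* g :+ ν :* f))) refl _ p g (α * ᾱ) (con ν) f ⟩
        p * (p * (con (b -ᴷ c) * g + con ν * f)) ∎))
      where
      x = var l ; y = var m ; p = x - y ; g = T f
      α = A x y ; ᾱ = A y x ; β = B x y ; β̄ = B y x
      cancel : ∀ {f g} → p * f ≈ p * g → f ≈ g
      cancel = [xᵢ-xⱼ]-cancelˡ l≢m _ _
      α-ᾱ : α - ᾱ ≈ con (b -ᴷ c) * p
      α-ᾱ = trans
        (solve 6 (λ a b c d x y →
          (a :* x :* y :+ b :* x :+ c :* y :+ d) :- (a :* y :* x :+ b :* y :+ c :* x :+ d)
          := (b :- c) :* (x :- y)) refl (con a) (con b) (con c) (con d) x y)
        (*-congʳ (sym (con-- b c)))

  module _ {ν ν′ B C} (B-kernel : IsKernel ν B) (C-kernel : IsKernel ν′ C) where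

    -- The two pairs of variables are disjoint, so each interchange fixes the coefficients and the
    -- denominator of the other operator, and the interchanges commute.
    IsDivided-commute : ∀ {i j k l T U} → i ≢ j → k ≢ l → i ≢ k → i ≢ l → j ≢ k → j ≢ l →
      IsDivided i j B T → IsDivided k l C U → ∀ f → T (U f) ≈ U (T f)
    IsDivided-commute {i} {j} {k} {l} {T} {U} i≢j k≢l i≢k i≢l j≢k j≢l T-div U-div f =
      [xᵢ-xⱼ]-cancelˡ i≢j _ _ ([xᵢ-xⱼ]-cancelˡ k≢l _ _ (begin
        q * (p * T (U f))
          ≈⟨ *-congˡ (T-div (U f)) ⟩
        q * (α * U f - β * swap i j (U f))
          ≈⟨ expand q α β _ _ ⟩
        α * (q * U f) - β * (q * swap i j (U f))
          ≈⟨ sub-cong (*-congˡ (U-div f)) (*-congˡ (Divided-swap C-kernel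
               (transpose-other (≡.≢-sym i≢k) (≡.≢-sym j≢k))
               (transpose-other (≡.≢-sym i≢l) (≡.≢-sym j≢l)) (U-div f))) ⟩
        α * (α′ * f - γ * swap k l f) - β * (α′ * swap i j f - γ * swap i j (swap k l f))
          ≈⟨ sub-cong refl (*-congˡ (sub-cong refl (*-congˡ (swap-commute i≢k i≢l j≢k j≢l f)))) ⟩
        α * (α′ * f - γ * swap k l f) - β * (α′ * swap i j f - γ * swap k l (swap i j f))
          ≈⟨ solve 8 (λ α β α′ γ f tf sf stf →
               α :* (α′ :* f :- γ :* tf) :- β :* (α′ :* sf :- γ :* stf)
               := α′ :* (α :* f :- β :* sf) :- γ :* (α :* tf :- β :* stf))
               refl α β α′ γ f _ _ _ ⟩
        α′ * (α * f - β * swap i j f) - γ * (α * swap k l f - β * swap k l (swap i j f))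
          ≈⟨ sub-cong (*-congˡ (T-div f)) (*-congˡ (Divided-swap B-kernel
               (transpose-other i≢k i≢l) (transpose-other j≢k j≢l) (T-div f))) ⟨
        α′ * (p * T f) - γ * (p * swap k l (T f))
          ≈⟨ expand p α′ γ _ _ ⟨
        p * (α′ * T f - γ * swap k l (T f))
          ≈⟨ *-congˡ (U-div (T f)) ⟨
        p * (q * U (T f))
          ≈⟨ solve 3 (λ p q g → p :* (q :* g) := q :* (p :* g)) refl p q _ ⟩
        q * (p * U (T f)) ∎))
      where
      p = var i - var j ; q = var k - var l
      α = A (var i) (var j) ; β = B (var i) (var j)
      α′ = A (var k) (var l) ; γ = C (var k) (var l)
      expand : ∀ q α β g h → q * (α * g - β * h) ≈ α * (q * g) - β * (q * h)
      expand = solve 5 (λ q α β g h → q :* (α :* g :- β :* h) := α :* (q :* g) :- β :* (q :* h)) refl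

  module _ {ν B C} (B-kernel : IsKernel ν B) (C-kernel : IsKernel ν C)
    (BCB≈CBC : ∀ x y z → B x y * C x z * B y z ≈ C y z * B x z * C x y)
    where

    private
      module B = IsKernel B-kernel
      module C = IsKernel C-kernel

    -- Both sides are multiplied by `p * q * r` and compared coefficient by coefficient at the six
    -- images of `f`.
    IsDivided-braid : ∀ {i j k T U} → i ≢ j → j ≢ k → i ≢ k →
      IsDivided i j B T → IsDivided j k C U → ∀ f → T (U (T f)) ≈ U (T (U f))
    IsDivided-braid {i} {j} {k} {T} {U} i≢j j≢k i≢k T-div U-div f =
      [xᵢ-xⱼ]-cancelˡ i≢j _ _ ([xᵢ-xⱼ]-cancelˡ j≢k _ _ ([xᵢ-xⱼ]-cancelˡ i≢k _ _ (begin
        r * (q * (p * T (U (T f))))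
          ≈⟨ solve 4 (λ p q r g → r :* (q :* (p :* g)) := p :* q :* r :* g) refl p q r _ ⟩
        p * q * r * T (U (T f))
          -- Here α, α′, α″, ᾱ are A(x,y), A(y,z), A(x,z), A(y,x); the letters β and γ stand for the
          -- values of B and C at the corresponding arguments.
          ≈⟨ [xᵢ-xⱼ]-cancelˡ i≢j _ _ (expand-braid
               (T-div (U (T f)))
               (U-div (T f))
               (swap-U ij-j ij-k (U-div (T f)))
               (T-div f)
               (swap-IsDivided B-kernel T-div f)
               (swap-T jk-i jk-j (T-div f))
               (swap-T ij-i ij-k (swap-T jk-i jk-j (T-div f)))
               (B.norm x y)
               (A-braidˡ x y z)) ⟩
        (A x y * A y z * A x z + con ν * p * q * A x z) * f - B x y * A y z * A x z * s f
          - A x y * C y z * A x z * t f + A x y * C y z * B x z * t (s f)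
          + B x y * C x z * A y z * s (t f) - B x y * C x z * B y z * s (t (s f))
          -- Five of the six terms agree after reordering factors and summands. The sixth, at the
          -- image under the longest element of S₃, needs `BCB≈CBC` and the braid relation of the
          -- interchanges.
          ≈⟨ sub-cong
               (solve 13 (λ α α′ α″ νpqα β γ′ γ″ β″ f sf tf tsf stf →
                 (α :* α′ :* α″ :+ νpqα) :* f :- β :* α′ :* α″ :* sf
                   :- α :* γ′ :* α″ :* tf :+ α :* γ′ :* β″ :* tsf :+ β :* γ″ :* α′ :* stf
                 := (α′ :* α :* α″ :+ νpqα) :* f :- γ′ :* α :* α″ :* tf
                   :- α′ :* β :* α″ :* sf :+ α′ :* β :* γ″ :* stf :+ γ′ :* β″ :* α :* tsf)
                 refl _ _ _ _ _ _ _ _ _ _ _ _ _)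
               (*-cong (BCB≈CBC x y z) (swap-braid i≢j j≢k i≢k f)) ⟩
        (A y z * A x y * A x z + con ν * p * q * A x z) * f - C y z * A x y * A x z * t f
          - A y z * B x y * A x z * s f + A y z * B x y * C x z * s (t f)
          + C y z * B x z * A x y * t (s f) - C y z * B x z * C x y * t (s (t f))
          ≈⟨ +-congʳ (+-congʳ (+-congʳ (+-congʳ (+-congʳ (*-congʳ (+-congˡ (*-congʳ
               (solve 3 (λ ν p q → ν :* p :* q := ν :* q :* p) refl (con ν) p q)))))))) ⟩
        (A y z * A x y * A x z + con ν * q * p * A x z) * f - C y z * A x y * A x z * t f
          - A y z * B x y * A x z * s f + A y z * B x y * C x z * s (t f)
          + C y z * B x z * A x y * t (s f) - C y z * B x z * C x y * t (s (t f))
          ≈⟨ [xᵢ-xⱼ]-cancelˡ j≢k _ _ (expand-braid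
               (U-div (T (U f)))
               (T-div (U f))
               (swap-T jk-i jk-j (T-div (U f)))
               (U-div f)
               (swap-IsDivided C-kernel U-div f)
               (swap-U ij-j ij-k (U-div f))
               (swap-U jk-i jk-k (swap-U ij-j ij-k (U-div f)))
               (C.norm y z)
               (A-braidʳ x y z)) ⟨
        q * p * r * U (T (U f))
          ≈⟨ solve 4 (λ p q r g → q :* p :* r :* g := r :* (q :* (p :* g))) refl p q r _ ⟩
        r * (q * (p * U (T (U f)))) ∎)))
      where
      x = var i ; y = var j ; z = var k
      p = x - y ; q = y - z ; r = x - z
      s = swap i j ; t = swap j k
      ij-i = transpose-matchˡ i j
      ij-j = transpose-matchʳ i j
      ij-k = transpose-other (≡.≢-sym i≢k) (≡.≢-sym j≢k)
      jk-i = transpose-other i≢j i≢k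
      jk-j = transpose-matchˡ j k
      jk-k = transpose-matchʳ j k
      swap-T = Divided-swap B-kernel
      swap-U = Divided-swap C-kernel

-- Positions of the variables xᵢ and xᵢ₊₁.

toℕ-left : ∀ {n} (i : Fin (pred n)) → toℕ (left {n} i) ≡ toℕ i
toℕ-left {ℕ.suc _} i = toℕ-inject₁ i

toℕ-right : ∀ {n} (i : Fin (pred n)) → toℕ (right {n} i) ≡ ℕ.suc (toℕ i)
toℕ-right {ℕ.suc _} i = ≡.refl

toℕ-≢ : ∀ {n} {i j : Fin n} → toℕ i ≢ toℕ j → i ≢ j
toℕ-≢ i≢j ≡.refl = i≢j ≡.refl

-- These inequalities keep xₘ, xₘ₊₁ apart from xₙ, xₙ₊₁; the remaining one, between the two
-- right-hand positions, reduces to the first.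
2≤∣-∣⇒≢ : ∀ {m n} → 2 ≤ℕ ℕ.∣ n - m ∣ → m ≢ n × m ≢ ℕ.suc n × ℕ.suc m ≢ n
2≤∣-∣⇒≢ {m} {n} 2≤ =
    (λ { ≡.refl → contradiction (≡.subst (2 ≤ℕ_) (ℕ.∣n-n∣≡0 m) 2≤) λ () })
  , (λ { ≡.refl → contradiction (≡.subst (2 ≤ℕ_) (∣n-1+n∣≡1 n) 2≤) λ { (ℕ.s≤s ()) } })
  , (λ { ≡.refl → contradiction
         (≡.subst (2 ≤ℕ_) (≡.trans (ℕ.∣-∣-comm (ℕ.suc m) m) (∣n-1+n∣≡1 m)) 2≤) λ { (ℕ.s≤s ()) } })
  where
  ∣n-1+n∣≡1 : ∀ n → ℕ.∣ n - ℕ.suc n ∣ ≡ 1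
  ∣n-1+n∣≡1 ℕ.zero    = ≡.refl
  ∣n-1+n∣≡1 (ℕ.suc n) = ∣n-1+n∣≡1 n

choose : ∀ {a} {X : Set a} → Bool → X → X → X
choose true  x y = x
choose false x y = y

-- The operators πᵢ and their Hecke relations.

module HeckeOperators {κ ℓ₁ ℓ₂} (K : HeytingField κ ℓ₁ ℓ₂) (n : ℕ)
  (a b c d : HeytingField.Carrier K)
  (ad-bc≈0 : ZeroDeterminant
    (HeytingCommutativeRing.commutativeRing (HeytingField.heytingCommutativeRing K)) a b c d)
  where

  private
    R = HeytingCommutativeRing.commutativeRing (HeytingField.heytingCommutativeRing K)

  open HeytingField K using () renaming
    (Carrier to F; _+_ to _+ᴷ_; _*_ to _*ᴷ_; _-_ to _-ᴷ_; 0# to 0ᴷ)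
  open Operators K n
  open Polynomials R n using (con-+; con-*)
  open DividedOperators R n a b c d ad-bc≈0
  open CommutativeRing polynomialRing hiding (_≉_)
  open SetoidReasoning setoid
  open IntegerSolver polynomialRing
  open BraidAlgebra polynomialRing

  -- B is allowed to vary with the index because in case (2) the triples are chosen independently
  -- for each i.
  generateHecke : ∀ {ν} (B : Index → Poly → Poly → Poly) → (∀ i → IsKernel ν (B i)) →
    (∀ i k x y z → B i x y * B k x z * B i y z ≈ B k y z * B i x z * B k x y) →
    (T : Index → Operator) → (∀ i → IsDivided (left i) (right i) (B i) (T i ⟨$⟩_)) →
    GenerateHecke T (b -ᴷ c) ν
  generateHecke B isKernel B-braid T T-div = record
    { commute = λ i k 2≤ → let (i≢k , i≢1+k , 1+i≢k) = 2≤∣-∣⇒≢ 2≤ in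
        IsDivided-commute (isKernel i) (isKernel k) (left≢right i) (left≢right k)
          (toℕ-≢ λ p → i≢k (≡.trans (≡.sym (toℕ-left i)) (≡.trans p (toℕ-left k))))
          (toℕ-≢ λ p → i≢1+k (≡.trans (≡.sym (toℕ-left i)) (≡.trans p (toℕ-right k))))
          (toℕ-≢ λ p → 1+i≢k (≡.trans (≡.sym (toℕ-right i)) (≡.trans p (toℕ-left k))))
          (toℕ-≢ λ p → i≢k (ℕ.suc-injective (≡.trans (≡.sym (toℕ-right i)) (≡.trans p (toℕ-right k)))))
          (T-div i) (T-div k)
    ; braid = λ i k k≡1+i →
        -- For k = i + 1 the shared variable is both `left k` and `right i`. These are only
        -- propositionally equal, so the facts about `k` are transported.
        let leftk≡righti = toℕ-injective (≡.trans (toℕ-left k) (≡.trans k≡1+i (≡.sym (toℕ-right i)))) in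
        IsDivided-braid (isKernel i) (isKernel k) (B-braid i k) (left≢right i)
          (≡.subst (_≢ right k) leftk≡righti (left≢right k))
          -- The third variable has position i + 2, hence the implicit argument 1 in m ≢ 1 + n + m.
          (toℕ-≢ λ p → ℕ.m≢1+n+m (toℕ i) {1} (≡.trans (≡.sym (toℕ-left i))
            (≡.trans p (≡.trans (toℕ-right k) (≡.cong ℕ.suc k≡1+i)))))
          (T-div i)
          (≡.subst (λ j → IsDivided j (right k) (B k) (T k ⟨$⟩_)) leftk≡righti (T-div k))
    ; quadratic = λ i → IsDivided-quadratic (isKernel i) (left≢right i) (T-div i)
    }

  -- Multiplying by x - y and using `∂-spec`, the coefficient of f becomes P + Q + (x - y) R and
  -- that of -sᵢ f becomes sᵢ P + Q. That sᵢ is multiplicative on `P * f` holds by computation.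
  π-IsDivided : ∀ B i τ → let open Triple τ in
    P⁺ + Q₊ + (xᵢ i - xᵢ₊₁ i) * R₊ ≈ A (xᵢ i) (xᵢ₊₁ i) →
    (s i ⟨$⟩ P⁺) + Q₊ ≈ B (xᵢ i) (xᵢ₊₁ i) →
    IsDivided (left i) (right i) B (π i τ ⟨$⟩_)
  π-IsDivided B i ⟨ P , Q , R ⟩ A-eq B-eq f = begin
    p * ((∂ i ⟨$⟩ (P * f)) + Q * (∂ i ⟨$⟩ f) + R * f)
      ≈⟨ solve 6 (λ p ∂Pf Q ∂f R f → p :* (∂Pf :+ Q :* ∂f :+ R :* f)
           := p :* ∂Pf :+ Q :* (p :* ∂f) :+ p :* R :* f) refl p _ Q _ R f ⟩
    p * (∂ i ⟨$⟩ (P * f)) + Q * (p * (∂ i ⟨$⟩ f)) + p * R * f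
      ≈⟨ +-congʳ (+-cong (∂-spec i (P * f)) (*-congˡ (∂-spec i f))) ⟩
    (P * f - (s i ⟨$⟩ P) * (s i ⟨$⟩ f)) + Q * (f - (s i ⟨$⟩ f)) + p * R * f
      ≈⟨ solve 6 (λ P sP Q pR f sf → P :* f :- sP :* sf :+ Q :* (f :- sf) :+ pR :* f
           := (P :+ Q :+ pR) :* f :- (sP :+ Q) :* sf) refl P _ Q (p * R) f _ ⟩
    (P + Q + p * R) * f - ((s i ⟨$⟩ P) + Q) * (s i ⟨$⟩ f)
      ≈⟨ sub-cong (*-congʳ A-eq) (*-congʳ B-eq) ⟩
    A (xᵢ i) (xᵢ₊₁ i) * f - B (xᵢ i) (xᵢ₊₁ i) * (s i ⟨$⟩ f) ∎
    where p = xᵢ i - xᵢ₊₁ i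

  -- With its companion, a rewrite rule for evaluating sᵢ on the variables of P: `transpose` decides
  -- equality of indices and is stuck on `left i` and `right i`.
  left↦right : ∀ i → transpose (left i) (right {n} i) (left i) ≡ right i
  left↦right i = transpose-matchˡ (left i) (right i)

  right↦left : ∀ i → transpose (left i) (right {n} i) (right i) ≡ left i
  right↦left i = transpose-matchʳ (left i) (right i)

  -- Case (1): one kernel for all indices.

  module _ (e : F) where

    B₁ : Poly → Poly → Poly
    B₁ u v = A v u + con e * (u - v)

    ν₁ : F
    ν₁ = e *ᴷ (e +ᴷ c -ᴷ b)

    -- As A(u,v) - A(v,u) = (b - c)(u - v), the cross terms of the product contribute e (b - c)(u -
    -- v)², and the last term contributes -e² (u - v)².
    B₁-isKernel : IsKernel ν₁ B₁
    B₁-isKernel = record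
      { swap-homo = λ i j u v → refl
      ; norm      = λ u v → begin
          B₁ u v * B₁ v u
            ≈⟨ solve 7 (λ a b c d e u v →
                 ((a :* v :* u :+ b :* v :+ c :* u :+ d) :+ e :* (u :- v))
                   :* ((a :* u :* v :+ b :* u :+ c :* v :+ d) :+ e :* (v :- u))
                 := (a :* u :* v :+ b :* u :+ c :* v :+ d) :* (a :* v :* u :+ b :* v :+ c :* u :+ d)
                   :- e :* (e :+ c :- b) :* ((u :- v) :* (u :- v)))
                 refl (con a) (con b) (con c) (con d) (con e) u v ⟩
          A u v * A v u - con e * (con e + con c - con b) * ((u - v) * (u - v))
            ≈⟨ sub-cong refl (*-congʳ con-ν₁) ⟨
          A u v * A v u - con ν₁ * ((u - v) * (u - v)) ∎
      }
      where
      con-ν₁ : con ν₁ ≈ con e * (con e + con c - con b)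
      con-ν₁ = trans (con-* _ _) (*-congˡ (trans (con-- _ _) (+-congʳ (con-+ _ _))))

    B₁-braid : ∀ x y z → B₁ x y * B₁ x z * B₁ y z ≈ B₁ y z * B₁ x z * B₁ x y
    B₁-braid x y z = solve 3 (λ p q r → p :* q :* r := r :* q :* p) refl _ _ _

    π₁-IsDivided : ∀ i → IsDivided (left i) (right i) B₁ (π i (triple₁ a b c d e i) ⟨$⟩_)
    π₁-IsDivided i = π-IsDivided B₁ i (triple₁ a b c d e i)
      (begin
        con a * x * y + con (b -ᴷ e) * x + con c * y + con d + con e * x + (x - y) * 0#
          ≈⟨ +-cong (+-congʳ (+-congʳ (+-congʳ (+-congˡ (*-congʳ (con-- b e)))))) (zeroʳ _) ⟩
        con a * x * y + (con b - con e) * x + con c * y + con d + con e * x + 0#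
          ≈⟨ +-identityʳ _ ⟩
        con a * x * y + (con b - con e) * x + con c * y + con d + con e * x
          ≈⟨ solve 7 (λ a b c d e x y → a :* x :* y :+ (b :- e) :* x :+ c :* y :+ d :+ e :* x
               := a :* x :* y :+ b :* x :+ c :* y :+ d)
               refl (con a) (con b) (con c) (con d) (con e) x y ⟩
        A x y ∎)
      sP+Q
      where
      x = xᵢ i ; y = xᵢ₊₁ i
      sP+Q : (s i ⟨$⟩ Triple.P⁺ (triple₁ a b c d e i)) + con e * x ≈ B₁ x y
      sP+Q rewrite left↦right i | right↦left i = begin
        con a * y * x + con (b -ᴷ e) * y + con c * x + con d + con e * x
          ≈⟨ +-congʳ (+-congʳ (+-congʳ (+-congˡ (*-congʳ (con-- b e))))) ⟩
        con a * y * x + (con b - con e) * y + con c * x + con d + con e * x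
          ≈⟨ solve 7 (λ a b c d e x y → a :* y :* x :+ (b :- e) :* y :+ c :* x :+ d :+ e :* x
               := (a :* y :* x :+ b :* y :+ c :* x :+ d) :+ e :* (x :- y))
               refl (con a) (con b) (con c) (con d) (con e) x y ⟩
        B₁ x y ∎

  -- By A-rank1, a product of three values of A is symmetric separately in its
  -- three first and its three second arguments.
  choose-braid : (G : Poly → Poly → Poly → Poly) →
    (∀ u v w → G u v w ≈ G v u w) → (∀ u v w → G u v w ≈ G u w v) → ∀ α β x y z →
    G (choose α x y) (choose β x z) (choose α y z) ≈ G (choose β y z) (choose α x z) (choose β x y)
  -- In each of the four cases both sides have the same multiset of arguments.
  choose-braid G G-12 G-23 true  true  x y z = trans (G-23 _ _ _) (G-12 _ _ _)
  choose-braid G G-12 G-23 true  false x y z = G-12 _ _ _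
  choose-braid G G-12 G-23 false true  x y z = G-23 _ _ _
  choose-braid G G-12 G-23 false false x y z = trans (G-12 _ _ _) (G-23 _ _ _)

  -- Encodes the four kernels A(v,u), A(u,v), A(v,v), A(u,u) of case (2), where `true` selects u and
  -- `false` selects v. Choosing the two arguments of A separately lets `choose-braid` treat them
  -- one at a time.
  firstChoice secondChoice : Fin 4 → Bool
  firstChoice 0F = false
  firstChoice 1F = true
  firstChoice 2F = false
  firstChoice 3F = true
  secondChoice 0F = true
  secondChoice 1F = false
  secondChoice 2F = false
  secondChoice 3F = true

  B₂ : Fin 4 → Poly → Poly → Poly
  B₂ k u v = A (choose (firstChoice k) u v) (choose (secondChoice k) u v)

  B₂-isKernel : ∀ k → IsKernel 0ᴷ (B₂ k)
  B₂-isKernel k = record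
    { swap-homo = swap-homo k
    ; norm      = λ u v → trans (norm k u v) (sym (begin
        A u v * A v u - 0# * ((u - v) * (u - v))
          ≈⟨ +-congˡ (-‿cong (zeroˡ _)) ⟩
        A u v * A v u - 0#
          ≈⟨ +-congˡ (trans (sym (+-identityˡ _)) (-‿inverseʳ 0#)) ⟩
        A u v * A v u + 0#
          ≈⟨ +-identityʳ _ ⟩
        A u v * A v u ∎))
    }
    where
    swap-homo : ∀ k i j u v → swap i j (B₂ k u v) ≈ B₂ k (swap i j u) (swap i j v)
    swap-homo 0F i j u v = refl
    swap-homo 1F i j u v = refl
    swap-homo 2F i j u v = refl
    swap-homo 3F i j u v = refl

    norm : ∀ k u v → B₂ k u v * B₂ k v u ≈ A u v * A v u
    norm 0F u v = *-comm _ _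
    norm 1F u v = refl
    norm 2F u v = trans (A-rank1 v v u u) (*-comm _ _)
    norm 3F u v = A-rank1 u u v v

  B₂-braid : ∀ k l x y z → B₂ k x y * B₂ l x z * B₂ k y z ≈ B₂ l y z * B₂ k x z * B₂ l x y
  -- The first arguments of the three factors are rearranged with the second ones held fixed, and
  -- then the second ones.
  B₂-braid k l x y z = trans
    (choose-braid (λ u v w → A u _ * A v _ * A w _)
      (λ u v w → *-congʳ (A-rank1ˡ u _ v _))
      (λ u v w → trans (*-assoc _ _ _) (trans (*-congˡ (A-rank1ˡ v _ w _)) (sym (*-assoc _ _ _))))
      (firstChoice k) (firstChoice l) x y z)
    (choose-braid (λ u v w → A _ u * A _ v * A _ w)
      (λ u v w → *-congʳ (A-rank1 _ u _ v))
      (λ u v w → trans (*-assoc _ _ _) (trans (*-congˡ (A-rank1 _ v _ w)) (sym (*-assoc _ _ _))))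
      (secondChoice k) (secondChoice l) x y z)
    where
    A-rank1ˡ : ∀ u v w t → A u v * A w t ≈ A w v * A u t
    A-rank1ˡ u v w t = trans (*-comm _ _) (A-rank1 w t u v)

  π₂-IsDivided : ∀ k i → IsDivided (left i) (right i) (B₂ k) (π i (triple₂ a b c d k i) ⟨$⟩_)
  π₂-IsDivided k i = π-IsDivided (B₂ k) i (triple₂ a b c d k i) (P+Q+pR k) (sP+Q k)
    where
    x = xᵢ i ; y = xᵢ₊₁ i

    P+Q+pR : ∀ k → let open Triple (triple₂ a b c d k i) in P⁺ + Q₊ + (x - y) * R₊ ≈ A x y
    P+Q+pR 0F = trans (+-cong (+-identityʳ _) (zeroʳ _)) (+-identityʳ _)
    P+Q+pR 1F = begin
      con a * x * y + con c * x + con c * y + con d + con (b -ᴷ c) * x + (x - y) * 0#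
        ≈⟨ +-cong (+-congˡ (*-congʳ (con-- b c))) (zeroʳ _) ⟩
      con a * x * y + con c * x + con c * y + con d + (con b - con c) * x + 0#
        ≈⟨ +-identityʳ _ ⟩
      con a * x * y + con c * x + con c * y + con d + (con b - con c) * x
        ≈⟨ solve 6 (λ a b c d x y → a :* x :* y :+ c :* x :+ c :* y :+ d :+ (b :- c) :* x
             := a :* x :* y :+ b :* x :+ c :* y :+ d)
             refl (con a) (con b) (con c) (con d) x y ⟩
      A x y ∎
    P+Q+pR 2F = begin
      con a * (x * x) + con (b +ᴷ c) * x + con c * y + con d - con c * x + (x - y) * - (con a * x)
        ≈⟨ +-congʳ (+-congʳ (+-congʳ (+-congʳ (+-congˡ (*-congʳ (con-+ b c)))))) ⟩
      con a * (x * x) + (con b + con c) * x + con c * y + con d - con c * x + (x - y) * - (con a * x)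
        -- The term (x - y)(-a x) replaces a x² by a x y.
        ≈⟨ solve 6 (λ a b c d x y →
             a :* (x :* x) :+ (b :+ c) :* x :+ c :* y :+ d :- c :* x :+ (x :- y) :* (:- (a :* x))
             := a :* x :* y :+ b :* x :+ c :* y :+ d)
             refl (con a) (con b) (con c) (con d) x y ⟩
      A x y ∎
    P+Q+pR 3F = solve 6 (λ a b c d x y →
      (c :* y :+ d) :+ (a :* (x :* x) :+ b :* x) :+ (x :- y) :* (:- (a :* x))
      := a :* x :* y :+ b :* x :+ c :* y :+ d)
      refl (con a) (con b) (con c) (con d) x y

    sP+Q : ∀ k → let open Triple (triple₂ a b c d k i) in (s i ⟨$⟩ P⁺) + Q₊ ≈ B₂ k x y
    sP+Q 0F rewrite left↦right i | right↦left i =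
      +-identityʳ _
    sP+Q 1F rewrite left↦right i | right↦left i = begin
      con a * y * x + con c * y + con c * x + con d + con (b -ᴷ c) * x
        ≈⟨ +-congˡ (*-congʳ (con-- b c)) ⟩
      con a * y * x + con c * y + con c * x + con d + (con b - con c) * x
        ≈⟨ solve 6 (λ a b c d x y → a :* y :* x :+ c :* y :+ c :* x :+ d :+ (b :- c) :* x
             := a :* x :* y :+ b :* x :+ c :* y :+ d)
             refl (con a) (con b) (con c) (con d) x y ⟩
      A x y ∎
    sP+Q 2F rewrite left↦right i | right↦left i = begin
      con a * (y * y) + con (b +ᴷ c) * y + con c * x + con d - con c * x
        ≈⟨ +-congʳ (+-congʳ (+-congʳ (+-congˡ (*-congʳ (con-+ b c))))) ⟩
      con a * (y * y) + (con b + con c) * y + con c * x + con d - con c * x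
        ≈⟨ solve 6 (λ a b c d x y → a :* (y :* y) :+ (b :+ c) :* y :+ c :* x :+ d :- c :* x
             := a :* y :* y :+ b :* y :+ c :* y :+ d)
             refl (con a) (con b) (con c) (con d) x y ⟩
      A y y ∎
    sP+Q 3F rewrite right↦left i =
      solve 5 (λ a b c d x → (c :* x :+ d) :+ (a :* (x :* x) :+ b :* x)
        := a :* x :* x :+ b :* x :+ c :* x :+ d) refl (con a) (con b) (con c) (con d) x

proposition30 : ∀ {κ ℓ₁ ℓ₂} (K : HeytingField κ ℓ₁ ℓ₂) (n : ℕ) → 3 ≤ℕ n →
    let open HeytingField K
        open Operators K n in
    (a b c d : Carrier) →
    ¬ (a ≈ 0# × b ≈ 0# × c ≈ 0# × d ≈ 0#) →
    a * d - b * c ≈ 0# →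
    ((e : Carrier) → ¬ (e ≈ 0#) → ¬ (e ≈ b - c) →
      GenerateHecke (λ i → π i (triple₁ a b c d e i)) (b - c) (e * (e + c - b)))
    ×
    ((kind : Fin (pred n) → Fin 4) →
      GenerateHecke (λ i → π i (triple₂ a b c d (kind i) i)) (b - c) 0#)
proposition30 K n _ a b c d _ ad-bc≈0 =
    (λ e _ _ → generateHecke (λ _ → B₁ e) (λ _ → B₁-isKernel e) (λ _ _ → B₁-braid e) _ (π₁-IsDivided e))
  , (λ kind → generateHecke (λ i → B₂ (kind i)) (λ i → B₂-isKernel (kind i))
      (λ i k → B₂-braid (kind i) (kind k)) _ (λ i → π₂-IsDivided (kind i) i))
  where open HeckeOperators K n a b c d ad-bc≈0
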